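{- For every odd integer $p\ge 1$, in the $p$-round two-party communication model with a single output pass, Sliding-Min on inputs of length $N$ with values in $[0,R]$ can be solved using $O\big(p\,N^{1/p}\log R\big)$ bits of communication (the bound holds for every window size $K$, with an absolute implied constant).
   Context: Problem. The input is an array $A_0,\dots,A_{N-1}$ of integers in $[0,R]$ together with a window size $K\le N$. Sliding-Min asks for the minimum of $A_i,\dots,A_{i+K-1}$ for every $i\in\{0,\dots,N-K\}$. Two-party communication model. Both parties know $N,K,R$. Alice holds the first half of the array and Bob holds the second half. They alternately send messages, Alice first; each message is one round, and there are $p$ rounds. The answers for all $N-K+1$ windows must be written to a shared write-only output stream; at any of its turns a party may write any number of answers (some are written by Alice, some by Bob), and neither party can read the output stream or the current position in it. Every answer is written exactly once. A single output pass means that the answers are written in the order of increasing window index $i=0,1,\dots,N-K$. The communication cost is the total number of bits in the messages. -}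

module Defs where

open import Data.Bool.Base using (Bool)
open import Data.Fin.Base using (Fin; toℕ; inject≤; cast; _↑ʳ_)
open import Data.List.Base using (List; _++_; length; lookup)
open import Data.Nat.Base using (ℕ; zero; suc; _+_; _*_; _∸_; _^_; _≤_; _<_; ⌊_/2⌋; ⌈_/2⌉)
open import Data.Nat.Properties using (⌊n/2⌋≤n; ⌊n/2⌋+⌈n/2⌉≡n)
open import Data.Product.Base using (_×_; ∃-syntax)
open import Data.Vec.Base using (Vec)
open import Data.Vec.Functional using (Vector)
open import Relation.Binary.PropositionalEquality.Core using (_≡_)

data Party : Set where
  alice bob : Party

other : Party → Party
other alice = bob
other bob   = alice

-- Protocol I O q r: it is q's turn and r messages are still to be sent; I gives
-- the parties' inputs and O the values that may be written to the output stream.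
-- A node of the tree is a transcript so far, known to both parties, so what the
-- party to move writes and sends depends only on its own input and on the
-- transcript, never on the output stream.  The length ℓ of a message is fixed by
-- the transcript, so that length itself conveys no uncharged information; ℓ = 0
-- is allowed.  On receiving the last message a party has one more turn, in which
-- it only writes.
data Protocol (I : Party → Set) (O : Set) : Party → ℕ → Set where
  finish : ∀ {q} (write : I q → List O) → Protocol I O q zero
  round  : ∀ {q r} (ℓ : ℕ)
           (write : I q → List O)
           (send  : I q → Vec Bool ℓ)
           (next  : Vec Bool ℓ → Protocol I O (other q) r) →
           Protocol I O q (suc r)

module _ {I : Party → Set} {O : Set} where

  -- The stream is append-only: the k-th value written is the answer number k.
  output : ∀ {q r} → Protocol I O q r → (∀ q′ → I q′) → List O
  output {q} (finish write)             x = write (x q)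
  output {q} (round ℓ write send next) x =
    write (x q) ++ output (next (send (x q))) x

  cost : ∀ {q r} → Protocol I O q r → (∀ q′ → I q′) → ℕ
  cost     (finish write)            x = 0
  cost {q} (round ℓ write send next) x = ℓ + cost (next (send (x q))) x

Value : ℕ → Set
Value R = Fin (suc R)

halfLength : ℕ → Party → ℕ
halfLength N alice = ⌊ N /2⌋
halfLength N bob   = ⌈ N /2⌉

HalfInput : ℕ → ℕ → Party → Set
HalfInput N R q = Vector (Value R) (halfLength N q)

halves : ∀ {N R} → Vector (Value R) N → ∀ q → HalfInput N R q
halves {N} A alice i = A (inject≤ i (⌊n/2⌋≤n N))
halves {N} A bob   i = A (cast (⌊n/2⌋+⌈n/2⌉≡n N) (⌊ N /2⌋ ↑ʳ i))

InWindow : ∀ {N} → ℕ → ℕ → Fin N → Set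
InWindow K i j = i ≤ toℕ j × toℕ j < i + K

IsWindowMin : ∀ {N R} → ℕ → Vector (Value R) N → ℕ → Value R → Set
IsWindowMin K A i v =
  (∃[ j ] InWindow K i j × A j ≡ v) ×
  (∀ j → InWindow K i j → toℕ v ≤ toℕ (A j))

-- out lists the answers for the windows 0, 1, …, N ∸ K in this order.
IsSlidingMin : ∀ {N R} → ℕ → Vector (Value R) N → List (Value R) → Set
IsSlidingMin {N} K A out =
  length out ≡ suc (N ∸ K) ×
  (∀ i → IsWindowMin K A (toℕ i) (lookup out i))

-- c ≤[ a · N ^1/ p ] is the inequality c ≤ a · N^(1/p) between real numbers,
-- with both (nonnegative) sides raised to the p-th power; meaningful for p ≥ 1.
infix 4 _≤[_·_^1/_]

_≤[_·_^1/_] : ℕ → ℕ → ℕ → ℕ → Set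
c ≤[ a · N ^1/ p ] = c ^ p ≤ a ^ p * N

{-# OPTIONS --safe #-}

-- Let α(i) be the minimum of Alice's A_j with j ≥ i, and β(i) the minimum of
-- Bob's A_j with j < i + K.  If α(i) ≤ β(i), the answer to window i is the minimum
-- of Alice's part of the window, otherwise it is the minimum of Bob's part.  As α
-- is nondecreasing and β nonincreasing, Alice's windows form an initial segment
-- of length t, say.  With k = ⌊N^(1/p)⌋ there are at most N + 1 ≤ (k + 1)^p
-- candidates for t, and each message divides their number by k + 1: its sender
-- gives its key (α or β) at k equally spaced points of the current range.  Both
-- parties learn the subrange containing t because the next message repeats the
-- other key at the same points; it takes 2k values in all.  The last message,
-- Alice's, carries instead of new keys the answers of Alice's part for the k
-- windows whose owner is still unknown; Alice writes what precedes
-- these windows and Bob writes the rest.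
module Submission where

open import Defs
import Algebra.Construct.NaturalChoice.Min as Min
open import Data.Bool.Base using (Bool)
open import Data.Fin.Base as Fin using (Fin; zero; suc; toℕ; fromℕ; fromℕ<; inject≤; cast; _↑ʳ_; remQuot; combine)
open import Data.Fin.Properties as Fin using (toℕ<n; toℕ-fromℕ<; toℕ-injective; toℕ-inject≤; toℕ-cast; toℕ-↑ʳ; ≤fromℕ; 2↔Bool; combine-remQuot)
open import Data.List.Base using (List; []; _∷_; _++_; map; filter; allFin; applyUpTo)
open import Data.List.Membership.Propositional.Properties using (∈-map⁺; ∈-map⁻; ∈-filter⁺; ∈-filter⁻; ∈-allFin)
open import Data.List.Properties using (length-applyUpTo; lookup-applyUpTo)
import Data.List.Extrema as Extrema
import Data.List.Relation.Unary.All as All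
open import Data.List.Relation.Unary.All.Properties using (map⁺; all-filter)
open import Data.Nat using (ℕ; zero; suc; pred; _+_; _*_; _∸_; _⊓_; _^_; _%_; _/_; _≤_; _<_; _≤?_; _<?_; z≤n; s≤s; s≤s⁻¹; ⌊_/2⌋; ⌈_/2⌉)
open import Data.Nat.DivMod using (_mod_; m%n<n; m<n⇒m%n≡m; m≡m%n+[m/n]*n)
open import Data.Nat.Induction using (<-wellFounded)
open import Data.Nat.Logarithm using (⌈log₂_⌉)
open import Data.Nat.Logarithm.Core using (⌈log2⌉)
open import Data.Nat.Properties hiding (⊓-glb)
open import Data.Nat.Tactic.RingSolver using (solve-∀)
open import Data.Product using (_×_; _,_; proj₁; proj₂; uncurry; Σ-syntax; ∃-syntax; ∃₂)
open import Data.Sum.Base using (inj₁; inj₂)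
open import Data.Vec.Base as Vec using (Vec; []; _∷_)
open import Data.Vec.Functional using (Vector)
open import Data.Vec.Properties using (take++drop≡id; ++-injective)
open import Function.Base using (id; _∘_)
open import Function.Bundles using (Inverse)
open import Induction.WellFounded using (Acc; acc)
open import Relation.Binary.PropositionalEquality using (_≡_; refl; sym; trans; cong; cong₂; subst; subst₂; module ≡-Reasoning)
open import Relation.Nullary.Decidable using (yes; no; _×-dec_)
open import Relation.Nullary.Negation using (contradiction)
open import Relation.Unary using (Pred; Decidable)
open import Level using (0ℓ)

-- Codes

record Code (A : Set) (ℓ : ℕ) : Set where
  field
    encode        : A → Vec Bool ℓ
    decode        : Vec Bool ℓ → A
    decode-encode : ∀ a → decode (encode a) ≡ a

open Code

retract : ∀ {A B ℓ} (f : A → B) (g : B → A) → (∀ a → g (f a) ≡ a) → Code B ℓ → Code A ℓ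
retract f g g-f c .encode          = encode c ∘ f
retract f g g-f c .decode          = g ∘ decode c
retract f g g-f c .decode-encode a = trans (cong g (decode-encode c (f a))) (g-f a)

_⊗_ : ∀ {A B m n} → Code A m → Code B n → Code (A × B) (m + n)
(_⊗_ c d) .encode (a , b) = encode c a Vec.++ encode d b
_⊗_ {m = m} c d .decode bs = decode c (Vec.take m bs) , decode d (Vec.drop m bs)
_⊗_ {m = m} c d .decode-encode (a , b) =
  cong₂ _,_ (trans (cong (decode c) (proj₁ parts)) (decode-encode c a))
            (trans (cong (decode d) (proj₂ parts)) (decode-encode d b))
  where
  bs = encode c a Vec.++ encode d b
  parts = ++-injective (Vec.take m bs) (encode c a) (take++drop≡id m bs)

emptyCode : ∀ {A} (a : A) → (∀ b → a ≡ b) → Code A 0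
emptyCode a contr .encode _        = []
emptyCode a contr .decode _        = a
emptyCode a contr .decode-encode b = contr b

bitCode : Code (Fin 2) 1
bitCode .encode i              = Inverse.to 2↔Bool i ∷ []
bitCode .decode (b ∷ [])       = Inverse.from 2↔Bool b
bitCode .decode-encode i       = Inverse.strictlyInverseʳ 2↔Bool i

binaryCode : ∀ ℓ → Code (Fin (2 ^ ℓ)) ℓ
binaryCode zero    = emptyCode zero λ { zero → refl }
binaryCode (suc ℓ) =
  retract (remQuot {2} (2 ^ ℓ)) (uncurry combine) (combine-remQuot {2} (2 ^ ℓ)) (bitCode ⊗ binaryCode ℓ)

vecCode : ∀ {A ℓ} → Code A ℓ → ∀ n → Code (Vec A n) (n * ℓ)
vecCode c zero    = emptyCode [] λ { [] → refl }
vecCode c (suc n) = retract Vec.uncons (uncurry _∷_) (λ { (_ ∷ _) → refl }) (c ⊗ vecCode c n)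

-- The induction copies the recursion of `⌈log2⌉`, which passes from 2 + n to 1 + ⌈n/2⌉ along the
-- accessibility proof; hence `rec` is arbitrary.
n≤2^⌈log2⌉n : ∀ n (rec : Acc _<_ n) → n ≤ 2 ^ ⌈log2⌉ n rec
n≤2^⌈log2⌉n 0             _        = z≤n
n≤2^⌈log2⌉n 1             _        = ≤-refl
n≤2^⌈log2⌉n (suc (suc n)) (acc rs) = begin
  2 + n                       ≡⟨ cong (2 +_) (⌊n/2⌋+⌈n/2⌉≡n n) ⟨
  2 + (⌊ n /2⌋ + ⌈ n /2⌉)     ≤⟨ +-monoʳ-≤ 2 (+-monoˡ-≤ ⌈ n /2⌉ (⌊n/2⌋≤⌈n/2⌉ n)) ⟩
  2 + (⌈ n /2⌉ + ⌈ n /2⌉)     ≡⟨ cong suc (+-suc ⌈ n /2⌉ ⌈ n /2⌉) ⟨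
  suc ⌈ n /2⌉ + suc ⌈ n /2⌉   ≡⟨ cong (suc ⌈ n /2⌉ +_) (+-identityʳ _) ⟨
  2 * suc ⌈ n /2⌉             ≤⟨ *-monoʳ-≤ 2 (n≤2^⌈log2⌉n (suc ⌈ n /2⌉) (rs (⌈n/2⌉<n n))) ⟩
  2 * 2 ^ ⌈log2⌉ (suc ⌈ n /2⌉) _ ∎
  where open ≤-Reasoning

valueCode : ∀ R → Code (Value R) ⌈log₂ suc R ⌉
valueCode R =
  -- Words for numbers above R encode nothing and may decode to anything; reduction modulo R + 1
  -- fixes all the others.
  retract (λ v → inject≤ v (n≤2^⌈log2⌉n (suc R) (<-wellFounded _))) (λ i → toℕ i mod suc R) inverse
    (binaryCode ⌈log₂ suc R ⌉)
  where
  inverse : ∀ v → toℕ (inject≤ v _) mod suc R ≡ v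
  inverse v = toℕ-injective (begin
    toℕ (toℕ (inject≤ v _) mod suc R) ≡⟨ toℕ-fromℕ< (m%n<n (toℕ (inject≤ v _)) (suc R)) ⟩
    toℕ (inject≤ v _) % suc R         ≡⟨ cong (_% suc R) (toℕ-inject≤ v _) ⟩
    toℕ v % suc R                     ≡⟨ m<n⇒m%n≡m (toℕ<n v) ⟩
    toℕ v                             ∎)
    where open ≡-Reasoning

module _ {I : Party → Set} {O A : Set} {ℓ : ℕ} {q : Party} {r : ℕ} (c : Code A ℓ)
         (write : I q → List O) (send : I q → A) (next : A → Protocol I O (other q) r) where

  -- Opaque, so that unification can recover write, send and next.
  opaque
    transmit : Protocol I O q (suc r)
    transmit = round ℓ write (encode c ∘ send) (next ∘ decode c)

    output-transmit : ∀ x → output transmit x ≡ write (x q) ++ output (next (send (x q))) x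
    output-transmit x = cong (λ a → write (x q) ++ output (next a) x) (decode-encode c (send (x q)))

    cost-transmit : ∀ x → cost transmit x ≡ ℓ + cost (next (send (x q))) x
    cost-transmit x = cong (λ a → ℓ + cost (next a) x) (decode-encode c (send (x q)))

-- Lists and vectors

lookupOr : ∀ {A : Set} {n} → A → Vec A n → ℕ → A
lookupOr d []       i       = d
lookupOr d (x ∷ xs) zero    = x
lookupOr d (x ∷ xs) (suc i) = lookupOr d xs i

lookupOr-tabulate : ∀ {A : Set} {d : A} (f : ℕ → A) {n i} → i < n →
                    lookupOr d (Vec.tabulate {n = n} (f ∘ toℕ)) i ≡ f i
lookupOr-tabulate f {suc n} {zero}  _         = refl
lookupOr-tabulate f {suc n} {suc i} (s≤s i<n) = lookupOr-tabulate (f ∘ suc) i<n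

lookupOr-default : ∀ {A : Set} {d : A} {n} (xs : Vec A n) {i} → n ≤ i → lookupOr d xs i ≡ d
lookupOr-default []       _         = refl
lookupOr-default (x ∷ xs) (s≤s n≤i) = lookupOr-default xs n≤i

-- The cut m may lie beyond n: then the first list is shortened to length n and the second is empty.
applyUpTo-split : ∀ {A : Set} {f g h : ℕ → A} m n →
                  (∀ i → i < m → f i ≡ h i) → (∀ i → m + i < n → g i ≡ h (m + i)) →
                  applyUpTo f (m ⊓ n) ++ applyUpTo g (n ∸ m) ≡ applyUpTo h n
applyUpTo-split zero    zero    f≡h g≡h = refl
applyUpTo-split {f = f} zero (suc n) f≡h g≡h =
  cong₂ _∷_ (g≡h 0 (s≤s z≤n)) (applyUpTo-split {f = f} zero n (λ _ ()) (λ i i<n → g≡h (suc i) (s≤s i<n)))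
applyUpTo-split (suc m) zero    f≡h g≡h = refl
applyUpTo-split (suc m) (suc n) f≡h g≡h =
  cong₂ _∷_ (f≡h 0 (s≤s z≤n))
    (applyUpTo-split m n (λ i i<m → f≡h (suc i) (s≤s i<m)) (λ i i<n → g≡h i (s≤s i<n)))

-- Minima of values

module _ {R : ℕ} where

  open Min (Fin.≤-totalOrder (suc R)) public
    using (x⊓y≤x; x⊓y≤y; x≤y⇒x⊓y≈x; x≤y⇒y⊓x≈x; ⊓-glb; ⊓-identityˡ) renaming (_⊓_ to _⊓ᵛ_)
  open Extrema (Fin.≤-totalOrder (suc R)) using (min; min≤xs; v≤min⁺; argmin-sel)

  module _ {n : ℕ} {P : Pred (Fin n) 0ℓ} (P? : Decidable P) (x : Vector (Value R) n) where

    -- The minimum over the empty set is R.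
    minOver : Value R
    minOver = min (fromℕ R) (map x (filter P? (allFin n)))

    minOver≤ : ∀ {j} → P j → minOver Fin.≤ x j
    minOver≤ {j} Pj = All.lookup (min≤xs _ _) (∈-map⁺ x (∈-filter⁺ P? (∈-allFin j) Pj))

    ≤minOver : ∀ {v} → (∀ j → P j → v Fin.≤ x j) → v Fin.≤ minOver
    ≤minOver {v} v≤x = v≤min⁺ (≤fromℕ v) (map⁺ (All.map (λ {j} → v≤x j) (all-filter P? (allFin n))))

    minOver-attained : ∀ {j} → P j → ∃[ i ] P i × x i ≡ minOver
    minOver-attained {j} Pj with argmin-sel id (fromℕ R) (map x (filter P? (allFin n)))
    -- The minimum is the default R, so the given j attains it: its value lies between the minimum R
    -- and the largest value R.
    ... | inj₁ min≡R =
      j , Pj , Fin.≤-antisym (subst (x j Fin.≤_) (sym min≡R) (≤fromℕ (x j))) (minOver≤ Pj)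
    ... | inj₂ min∈ with ∈-map⁻ x min∈
    ...   | i , i∈ , min≡xi = i , proj₂ (∈-filter⁻ P? {xs = allFin n} i∈) , sym min≡xi

-- The search

module _ {R : ℕ} where

  -- The points are the last indices of consecutive blocks of length d, whence `pred`: f ≤ g at lo +
  -- d - 1 discards the candidates below lo + d, and its failure discards those from lo + d on.
  sample : (ℕ → Value R) → ℕ → ℕ → ∀ n → Vec (Value R) n
  sample f lo d zero    = []
  sample f lo d (suc n) = f (pred (lo + d)) ∷ sample f (lo + d) d n

  locate : ∀ {n} → ℕ → ℕ → Vec (Value R) n → Vec (Value R) n → ℕ
  locate lo d []       []       = lo
  locate lo d (a ∷ as) (b ∷ bs) with a Fin.≤? b
  ... | yes _ = locate (lo + d) d as bs
  ... | no  _ = lo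

  -- The candidates for a crossing index t, with f i ≤ g i for i < t and g i ≤ f i for
  -- t ≤ i < T, have been narrowed down to lo, …, lo + s ∸ 1.
  record Bracket (T : ℕ) (f g : ℕ → Value R) (lo s : ℕ) : Set where
    field
      below : ∀ i → i < lo → f i Fin.≤ g i
      above : ∀ i → lo + s ≤ suc i → i < T → g i Fin.≤ f i

  open Bracket public

  -- By monotonicity, f ≤ g at one point spreads to all smaller indices, and its failure gives g ≤ f
  -- at all larger ones. The n points cut the range into n + 1 blocks.
  bracket-locate : ∀ {T f g} →
    (∀ {i j} → i ≤ j → f i Fin.≤ f j) → (∀ {i j} → i ≤ j → g j Fin.≤ g i) →
    ∀ n {lo} d → Bracket T f g lo (suc n * d) →
    Bracket T f g (locate lo d (sample f lo d n) (sample g lo d n)) d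
  bracket-locate mono anti zero {lo} d br = subst (Bracket _ _ _ lo) (+-identityʳ d) br
  bracket-locate {f = f} {g} mono anti (suc n) {lo} d br with f (pred (lo + d)) Fin.≤? g (pred (lo + d))
  ... | yes f≤g = bracket-locate mono anti n d record
    { below = λ i i<lo+d → let i≤ = <⇒≤pred i<lo+d in ≤-trans (mono i≤) (≤-trans f≤g (anti i≤))
    ; above = λ i → above br i ∘ subst (_≤ suc i) (+-assoc lo d _)
    }
  ... | no f≰g = record
    { below = below br
    ; above = λ i lo+d≤ _ →
        let ≤i = pred-mono-≤ lo+d≤ in ≤-trans (anti ≤i) (≤-trans (<⇒≤ (≰⇒> f≰g)) (mono ≤i))
    }

  module Search {I : Party → Set} (T k : ℕ) (key answer : ∀ q → I q → ℕ → Value R) where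

    bits : ℕ
    bits = ⌈log₂ suc R ⌉

    valuesCode : ∀ n → Code (Vec (Value R) n × Vec (Value R) k) (n * bits + k * bits)
    valuesCode n = vecCode (valueCode R) n ⊗ vecCode (valueCode R) k

    -- The number of candidates left to a party about to send when r messages, its own included, are
    -- still to come.
    spacing : ℕ → ℕ
    spacing r = suc k ^ r

    -- theirs holds Bob's keys at n points of the range starting at lo.
    search : ∀ m {n} (lo : ℕ) (theirs : Vec (Value R) n) → Protocol I (Value R) alice (suc (m * 2))
    search zero {n} lo theirs =
      transmit (valuesCode n)
        -- The initial range may extend beyond T, and so may `lo₁`.
        (λ x → applyUpTo (answer alice x) (lo₁ (ours x) ⊓ T))
        (λ x → ours x , Vec.tabulate (λ j → answer alice x (lo₁ (ours x) + toℕ j)))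
        (λ (as , vs) → finish λ y →
          -- Past the k transmitted answers the default R, neutral for `⊓ᵛ`, leaves Bob's answer
          -- alone.
          applyUpTo (λ i → lookupOr (fromℕ R) vs i ⊓ᵛ answer bob y (lo₁ as + i)) (T ∸ lo₁ as))
      where
      ours = λ x → sample (key alice x) lo (spacing 1) n
      lo₁  = λ as → locate lo (spacing 1) as theirs
    search (suc m) {n} lo theirs =
      transmit (valuesCode n) (λ _ → [])
        -- `ours` answers `theirs`, so that Bob too can compute `lo₁`; the second component opens
        -- the next subdivision.
        (λ x → ours x , sample (key alice x) (lo₁ (ours x)) d₂ k)
        (λ (as , as′) → transmit (valuesCode k) (λ _ → [])
          (λ y → let bs = sample (key bob y) (lo₁ as) d₂ k in
                 bs , sample (key bob y) (locate (lo₁ as) d₂ as′ bs) d₃ k)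
          (λ (bs , bs′) → search m (locate (lo₁ as) d₂ as′ bs) bs′))
      where
      d₁   = spacing (3 + m * 2)
      d₂   = spacing (2 + m * 2)
      d₃   = spacing (1 + m * 2)
      ours = λ x → sample (key alice x) lo d₁ n
      lo₁  = λ as → locate lo d₁ as theirs

    -- Every message holds at most 2k values: n is 0 in Alice's first message and k from then on.
    cost-search : ∀ m {n} lo (theirs : Vec (Value R) n) → n ≤ k → ∀ x →
                  cost (search m lo theirs) x ≤ suc (m * 2) * (k * bits + k * bits)
    cost-search zero {n} lo theirs n≤k x = begin
      cost (search zero lo theirs) x ≡⟨ cost-transmit (valuesCode n) _ _ _ x ⟩
      n * bits + k * bits + 0        ≤⟨ +-monoˡ-≤ 0 (+-monoˡ-≤ (k * bits) (*-monoˡ-≤ bits n≤k)) ⟩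
      1 * (k * bits + k * bits)      ∎
      where open ≤-Reasoning
    cost-search (suc m) {n} lo theirs n≤k x = begin
      cost (search (suc m) lo theirs) x
        ≡⟨ cost-transmit (valuesCode n) _ _ _ x ⟩
      n * bits + k * bits + _
        ≡⟨ cong (n * bits + k * bits +_) (cost-transmit (valuesCode k) _ _ _ x) ⟩
      n * bits + k * bits + (k * bits + k * bits + _)
        ≤⟨ +-mono-≤ (+-monoˡ-≤ (k * bits) (*-monoˡ-≤ bits n≤k))
             (+-monoʳ-≤ (k * bits + k * bits) (cost-search m _ _ ≤-refl x)) ⟩
      suc (suc m * 2) * (k * bits + k * bits) ∎
      where open ≤-Reasoning

    module _ (x : ∀ q → I q) where

      private
        α β u v : ℕ → Value R
        α = key alice (x alice)
        β = key bob (x bob)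
        u = answer alice (x alice)
        v = answer bob (x bob)

      module _ (mono : ∀ {i j} → i ≤ j → α i Fin.≤ α j) (anti : ∀ {i j} → i ≤ j → β j Fin.≤ β i)
               (α≤β⇒u≤v : ∀ i → α i Fin.≤ β i → u i Fin.≤ v i)
               (β≤α⇒v≤u : ∀ i → β i Fin.≤ α i → v i Fin.≤ u i) where

        -- `theirs` is taken to be Bob's true samples, so that each `locate` compares α with β and
        -- keeps a bracket. Where the bracket decides the owner, the owner's answer is already the
        -- minimum of both.
        output-search : ∀ m {n} lo → Bracket T α β lo (suc n * spacing (suc (m * 2))) →
          output (search m lo (sample β lo (spacing (suc (m * 2))) n)) x
          ≡ applyUpTo (λ i → u i ⊓ᵛ v i) T
        output-search zero {n} lo br =
          trans (output-transmit (valuesCode n) _ _ _ x)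
            (applyUpTo-split lo₁ T
              (λ i i<lo₁ → sym (x≤y⇒x⊓y≈x (α≤β⇒u≤v i (below br₁ i i<lo₁))))
              rest)
          where
          lo₁ = locate lo (spacing 1) (sample α lo (spacing 1) n) (sample β lo (spacing 1) n)
          br₁ : Bracket T α β lo₁ (spacing 1)
          br₁ = bracket-locate mono anti n (spacing 1) br
          rest : ∀ i → lo₁ + i < T →
                 lookupOr (fromℕ R) (Vec.tabulate {n = k} (λ j → u (lo₁ + toℕ j))) i ⊓ᵛ v (lo₁ + i)
                 ≡ u (lo₁ + i) ⊓ᵛ v (lo₁ + i)
          rest i lo₁+i<T with i <? k
          ... | yes i<k = cong (_⊓ᵛ v (lo₁ + i)) (lookupOr-tabulate (λ j → u (lo₁ + j)) i<k)
          ... | no  i≮k = begin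
            lookupOr (fromℕ R) us i ⊓ᵛ v (lo₁ + i)
              ≡⟨ cong (_⊓ᵛ v (lo₁ + i)) (lookupOr-default us (≮⇒≥ i≮k)) ⟩
            fromℕ R ⊓ᵛ v (lo₁ + i)
              ≡⟨ ⊓-identityˡ ≤fromℕ (v (lo₁ + i)) ⟩
            v (lo₁ + i)
              ≡⟨ x≤y⇒y⊓x≈x (β≤α⇒v≤u _ (above br₁ _ past lo₁+i<T)) ⟨
            u (lo₁ + i) ⊓ᵛ v (lo₁ + i) ∎
            where
            open ≡-Reasoning
            us = Vec.tabulate {n = k} (λ j → u (lo₁ + toℕ j))
            -- The k + 1 remaining candidates end at lo₁ + k, so `above` applies from that index on,
            -- exactly where the transmitted answers stop.
            past : lo₁ + suc k * 1 ≤ suc (lo₁ + i)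
            past = subst₂ _≤_ (cong (lo₁ +_) (sym (*-identityʳ (suc k)))) (+-suc lo₁ i)
                     (+-monoʳ-≤ lo₁ (s≤s (≮⇒≥ i≮k)))
        output-search (suc m) {n} lo br =
          trans (output-transmit (valuesCode n) _ _ _ x)
            (trans (output-transmit (valuesCode k) _ _ _ x)
              -- The inner step is the subdivision Alice resolves, the outer one Bob's; they chain
              -- because `spacing (suc r)` unfolds to `suc k * spacing r`.
              (output-search m _ (bracket-locate mono anti k _ (bracket-locate mono anti n _ br))))

-- Sliding windows

module _ (N K : ℕ) where

  position : ∀ q → Fin (halfLength N q) → Fin N
  position alice i = inject≤ i (⌊n/2⌋≤n N)
  position bob   i = cast (⌊n/2⌋+⌈n/2⌉≡n N) (⌊ N /2⌋ ↑ʳ i)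

  halves-position : ∀ {R} (A : Vector (Value R) N) q i → halves A q i ≡ A (position q i)
  halves-position A alice i = refl
  halves-position A bob   i = refl

  toℕ-position-bob : ∀ i → toℕ (position bob i) ≡ ⌊ N /2⌋ + toℕ i
  toℕ-position-bob i = trans (toℕ-cast _ (⌊ N /2⌋ ↑ʳ i)) (toℕ-↑ʳ ⌊ N /2⌋ i)

  alice<bob : ∀ i j → toℕ (position alice i) < toℕ (position bob j)
  alice<bob i j = begin-strict
    toℕ (position alice i) ≡⟨ toℕ-inject≤ i _ ⟩
    toℕ i                  <⟨ toℕ<n i ⟩
    ⌊ N /2⌋                ≤⟨ m≤m+n ⌊ N /2⌋ (toℕ j) ⟩
    ⌊ N /2⌋ + toℕ j        ≡⟨ toℕ-position-bob j ⟨
    toℕ (position bob j)   ∎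
    where open ≤-Reasoning

  position-surjective : ∀ j → ∃₂ λ q i → position q i ≡ j
  position-surjective j with toℕ j <? ⌊ N /2⌋
  ... | yes j<h = alice , fromℕ< j<h , toℕ-injective (trans (toℕ-inject≤ _ _) (toℕ-fromℕ< j<h))
  ... | no  j≮h = bob , fromℕ< j∸h<h′ , toℕ-injective (begin
      toℕ (position bob (fromℕ< j∸h<h′)) ≡⟨ toℕ-position-bob _ ⟩
      ⌊ N /2⌋ + toℕ (fromℕ< j∸h<h′)      ≡⟨ cong (⌊ N /2⌋ +_) (toℕ-fromℕ< j∸h<h′) ⟩
      ⌊ N /2⌋ + (toℕ j ∸ ⌊ N /2⌋)        ≡⟨ m+[n∸m]≡n (≮⇒≥ j≮h) ⟩
      toℕ j                              ∎)
    where
    open ≡-Reasoning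
    j∸h<h′ : toℕ j ∸ ⌊ N /2⌋ < ⌈ N /2⌉
    j∸h<h′ = +-cancelˡ-< ⌊ N /2⌋ _ _
      (subst₂ _<_ (sym (m+[n∸m]≡n (≮⇒≥ j≮h))) (sym (⌊n/2⌋+⌈n/2⌉≡n N)) (toℕ<n j))

  inWindow? : ∀ i → Decidable (InWindow {N} K i)
  inWindow? i j = (i ≤? toℕ j) ×-dec (toℕ j <? i + K)

  -- Each party keeps only one of the two window bounds. This makes the keys monotone in i, which
  -- the true answers need not be.
  Within : Party → ℕ → Fin N → Set
  Within alice i j = i ≤ toℕ j
  Within bob   i j = toℕ j < i + K

  within? : ∀ q i → Decidable (Within q i)
  within? alice i j = i ≤? toℕ j
  within? bob   i j = toℕ j <? i + K

  module _ {R : ℕ} where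

    key answer : ∀ q → HalfInput N R q → ℕ → Value R
    key    q x i = minOver (λ j → within? q i (position q j)) x
    answer q x i = minOver (λ j → inWindow? i (position q j)) x

    key-alice-mono : ∀ x {i j} → i ≤ j → key alice x i Fin.≤ key alice x j
    key-alice-mono x i≤j = ≤minOver _ x λ _ j≤ → minOver≤ _ x (≤-trans i≤j j≤)

    key-bob-anti : ∀ x {i j} → i ≤ j → key bob x j Fin.≤ key bob x i
    key-bob-anti x i≤j = ≤minOver _ x λ _ <i+K → minOver≤ _ x (<-≤-trans <i+K (+-monoˡ-≤ K i≤j))

    module _ (x : ∀ q → HalfInput N R q) (i : ℕ) where

      -- If Bob's part of window i is nonempty, Alice's part is everything she has from i on.
      alice-owns : key alice (x alice) i Fin.≤ key bob (x bob) i →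
                   answer alice (x alice) i Fin.≤ answer bob (x bob) i
      alice-owns α≤β = ≤minOver _ (x bob) λ j (_ , j<i+K) →
        ≤-trans (≤minOver _ (x alice) λ j′ i≤j′ →
                  minOver≤ _ (x alice) (i≤j′ , <-trans (alice<bob j′ j) j<i+K))
          (≤-trans α≤β (minOver≤ _ (x bob) j<i+K))

      -- If Alice's part of window i is nonempty, i precedes Bob's whole half, so his part is
      -- everything he has before i + K.
      bob-owns : key bob (x bob) i Fin.≤ key alice (x alice) i →
                 answer bob (x bob) i Fin.≤ answer alice (x alice) i
      bob-owns β≤α = ≤minOver _ (x alice) λ j (i≤j , _) →
        ≤-trans (≤minOver _ (x bob) λ j′ j′<i+K →
                  minOver≤ _ (x bob) (≤-trans i≤j (<⇒≤ (alice<bob j j′)) , j′<i+K))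
          (≤-trans β≤α (minOver≤ _ (x alice) i≤j))

    module _ (A : Vector (Value R) N) (i : ℕ) where

      answers : Value R
      answers = answer alice (halves A alice) i ⊓ᵛ answer bob (halves A bob) i

      answers≤answer : ∀ q → answers Fin.≤ answer q (halves A q) i
      answers≤answer alice = x⊓y≤x _ _
      answers≤answer bob   = x⊓y≤y (answer alice (halves A alice) i) _

      windowMin≤answer : ∀ q → minOver (inWindow? i) A Fin.≤ answer q (halves A q) i
      windowMin≤answer q = ≤minOver _ (halves A q) λ j win →
        subst (minOver (inWindow? i) A Fin.≤_) (sym (halves-position A q j)) (minOver≤ (inWindow? i) A win)

      answers≤window : ∀ j → InWindow K i j → answers Fin.≤ A j
      answers≤window j win with position-surjective j
      ... | q , j′ , refl = subst (answers Fin.≤_) (halves-position A q j′)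
        (≤-trans (answers≤answer q) (minOver≤ _ (halves A q) win))

      answers≡windowMin : answers ≡ minOver (inWindow? i) A
      answers≡windowMin = Fin.≤-antisym (≤minOver (inWindow? i) A answers≤window)
        (⊓-glb (windowMin≤answer alice) (windowMin≤answer bob))

      answers-isWindowMin : 1 ≤ K → i + K ≤ N → IsWindowMin K A i answers
      answers-isWindowMin 1≤K i+K≤N =
        subst (λ v → ∃[ j ] InWindow K i j × A j ≡ v) (sym answers≡windowMin)
          (minOver-attained (inWindow? i) A
            (≤-reflexive (sym (toℕ-fromℕ< i<N)) , subst (_< i + K) (sym (toℕ-fromℕ< i<N)) i<i+K))
        , answers≤window
        where
        i<i+K = m<m+n i 1≤K
        i<N   = <-≤-trans i<i+K i+K≤N

    answers-isSlidingMin : ∀ A → 1 ≤ K → K ≤ N → IsSlidingMin K A (applyUpTo (answers A) (suc (N ∸ K)))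
    answers-isSlidingMin A 1≤K K≤N = length-applyUpTo (answers A) (suc (N ∸ K)) , λ i →
      subst (IsWindowMin K A (toℕ i)) (sym (lookup-applyUpTo (answers A) (suc (N ∸ K)) i))
        (answers-isWindowMin A (toℕ i) 1≤K
          (subst (toℕ i + K ≤_) (m∸n+n≡m K≤N)
            (+-monoˡ-≤ K (s≤s⁻¹ (subst (toℕ i <_) (length-applyUpTo (answers A) (suc (N ∸ K))) (toℕ<n i))))))

-- Integer roots and the final bound

integerRoot : ∀ r N → ∃[ k ] k ^ suc r ≤ N × N < suc k ^ suc r
integerRoot r zero    = 0 , z≤n , m^n>0 1 (suc r)
integerRoot r (suc N) with integerRoot r N
... | k , k^≤N , N<[1+k]^ with suc N <? suc k ^ suc r
...   | yes 1+N< = k , m≤n⇒m≤1+n k^≤N , 1+N<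
-- The root grows by at most one, as N + 1 ≤ (k + 1)^(r + 1) < (k + 2)^(r + 1).
...   | no  1+N≮ = suc k , ≮⇒≥ 1+N≮ , ≤-<-trans N<[1+k]^ (^-monoˡ-< (suc r) (n<1+n (suc k)))

^-distribʳ-* : ∀ m n o → (m * n) ^ o ≡ m ^ o * n ^ o
^-distribʳ-* m n zero    = refl
^-distribʳ-* m n (suc o) =
  trans (cong (m * n *_) (^-distribʳ-* m n o)) ([m*n]*[o*p]≡[m*o]*[n*p] m n (m ^ o) (n ^ o))

proposition3p4 : ∃[ C ] (∀ (p : ℕ) → p % 2 ≡ 1 →
    ∀ (N K R : ℕ) → 1 ≤ K → K ≤ N →
    Σ[ P ∈ Protocol (HalfInput N R) (Value R) alice p ]
    (∀ (A : Vector (Value R) N) →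
    IsSlidingMin K A (output P (halves A))
    × cost P (halves A) ≤[ C * p * ⌈log₂ suc R ⌉ · N ^1/ p ]))
-- The constant 2 reflects the at most 2k values per message, with k ≤ N^(1/p).
proposition3p4 = 2 , λ p p%2≡1 →
  subst Solvable (sym (trans (m≡m%n+[m/n]*n p 2) (cong (_+ p / 2 * 2) p%2≡1))) (solve (p / 2))
  where
  Solvable : ℕ → Set
  Solvable p = ∀ (N K R : ℕ) → 1 ≤ K → K ≤ N →
    Σ[ P ∈ Protocol (HalfInput N R) (Value R) alice p ]
    (∀ (A : Vector (Value R) N) →
    IsSlidingMin K A (output P (halves A))
    × cost P (halves A) ≤[ 2 * p * ⌈log₂ suc R ⌉ · N ^1/ p ])

  solve : ∀ m → Solvable (suc (m * 2))
  solve m N K R 1≤K K≤N with integerRoot (m * 2) N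
  ... | k , k^p≤N , N<[1+k]^p = search m 0 [] , λ A → correct A , cheap A
    where
    p = suc (m * 2)
    T = suc (N ∸ K)
    open Search {R} T k (key N K) (answer N K)

    T≤N : T ≤ N
    T≤N = ∸-monoʳ-< 1≤K K≤N

    -- Both conditions are vacuous: nothing lies below 0, and T ≤ N < (k + 1)^p keeps every i < T
    -- below the largest candidate. The factor 1 is `suc n` for n = 0, as Bob has sent no keys yet.
    start : ∀ {f g} → Bracket T f g 0 (1 * spacing p)
    start .below _ ()
    start .above i s≤1+i i<T = contradiction (≤-trans i<T T≤N)
      (<⇒≱ (<-≤-trans N<[1+k]^p (subst (_≤ suc i) (*-identityˡ (spacing p)) s≤1+i)))

    correct : ∀ A → IsSlidingMin K A (output (search m 0 []) (halves A))
    correct A = subst (IsSlidingMin K A)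
      (sym (output-search (halves A) (key-alice-mono N K (halves A alice)) (key-bob-anti N K (halves A bob))
             (alice-owns N K (halves A)) (bob-owns N K (halves A)) m {0} 0 start))
      (answers-isSlidingMin N K A 1≤K K≤N)

    cheap : ∀ A → cost (search m 0 []) (halves A) ≤[ 2 * p * bits · N ^1/ p ]
    cheap A = begin
      cost (search m 0 []) (halves A) ^ p ≤⟨ ^-monoˡ-≤ p (cost-search m 0 [] z≤n (halves A)) ⟩
      (p * (k * bits + k * bits)) ^ p     ≡⟨ cong (_^ p) (rearrange p k bits) ⟩
      (2 * p * bits * k) ^ p              ≡⟨ ^-distribʳ-* (2 * p * bits) k p ⟩
      (2 * p * bits) ^ p * k ^ p          ≤⟨ *-monoʳ-≤ ((2 * p * bits) ^ p) k^p≤N ⟩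
      (2 * p * bits) ^ p * N              ∎
      where
      open ≤-Reasoning
      rearrange : ∀ p k b → p * (k * b + k * b) ≡ 2 * p * b * k
      rearrange = solve-∀
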